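{- Let $G$ be a supergraceful graph with $p$ nodes and $q$ edges having a total labeling $\varphi$ with $1 \in N(\varphi)$. Then for each integer $t \ge 0$ there exists a supergraceful graph with $p+t$ nodes and $q+t$ edges.
   Context: Graphs are finite, simple. For a labeling $\varphi: V(G) \to \mathbb{Z}_{>0}$ let $N(\varphi) = \{\varphi(x) : x \in V(G)\}$ and $E(\varphi) = \{|\varphi(x)-\varphi(y)| : xy \in E(G)\}$. A total labeling of a graph with $p$ nodes and $q$ edges is a map $\varphi$ such that the $p$ node labels and the $q$ edge labels are pairwise distinct and $N(\varphi) \cup E(\varphi) = \{1,\dots,p+q\}$; a graph is supergraceful if it admits a total labeling. -}

module Defs where

open import Data.Fin using (Fin; _<_; _<?_)
open import Data.List using (List; length; map; filter; allFin; cartesianProduct; _++_)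
open import Data.List.Relation.Unary.Unique.Propositional using (Unique)
open import Data.Nat using (ℕ; _+_; _≤_; ∣_-_∣)
open import Data.Product using (_×_; _,_; ∃; ∃-syntax)
open import Level using (0ℓ)
open import Relation.Binary using (Rel; Decidable; Symmetric; Irreflexive)
open import Relation.Binary.PropositionalEquality using (_≡_)
open import Relation.Nullary.Decidable using (_×-dec_)
open import Relation.Unary using (Pred; _∪_; _≐_)

record Graph (p : ℕ) : Set₁ where
  infix 4 _~_ _~?_
  field
    _~_    : Rel (Fin p) 0ℓ
    _~?_   : Decidable _~_
    symm   : Symmetric _~_
    irrefl : Irreflexive _≡_ _~_

  -- Each undirected edge is listed exactly once, smaller endpoint first.
  edges : List (Fin p × Fin p)
  edges = filter (λ (x , y) → (x <? y) ×-dec (x ~? y))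
                 (cartesianProduct (allFin p) (allFin p))

  size : ℕ
  size = length edges

open Graph public using (edges; size)

Labeling : ℕ → Set
Labeling p = Fin p → ℕ

N : ∀ {p} → Labeling p → Pred ℕ 0ℓ
N φ k = ∃[ x ] φ x ≡ k

E : ∀ {p} → Graph p → Labeling p → Pred ℕ 0ℓ
E G φ k = ∃[ x ] ∃[ y ] (x ~ y × ∣ φ x - φ y ∣ ≡ k)
  where open Graph G

-- All node and edge labels with multiplicity, so that uniqueness of this
-- list also separates labels of different edges and of nodes from edges.
labels : ∀ {p} → Graph p → Labeling p → List ℕ
labels {p} G φ = map φ (allFin p) ++ map (λ (x , y) → ∣ φ x - φ y ∣) (edges G)

record IsTotalLabeling {p} (G : Graph p) (φ : Labeling p) : Set where
  field
    positive : ∀ x → 1 ≤ φ x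
    distinct : Unique (labels G φ)
    covers   : N φ ∪ E G φ ≐ (λ k → 1 ≤ k × k ≤ p + size G)

Supergraceful : ∀ {p} → Graph p → Set
Supergraceful G = ∃ (IsTotalLabeling G)

{-# OPTIONS --safe #-}
-- If M = p + q is the largest label and φ x₀ = 1, then a new leaf with label
-- M + 2 attached to x₀ creates exactly the two labels M + 2 (node) and M + 1
-- (edge), and 1 is still a node label, so the step can be repeated.
module Submission where

open import Defs
open import Data.Nat using (ℕ; _+_)
open import Data.Product using (_×_; Σ-syntax)
open import Relation.Binary.PropositionalEquality using (_≡_)
open import Relation.Unary using (_∈_)

open import Data.Empty using (⊥)
open import Data.Fin using (Fin; zero; suc; _<_; _<?_)
open import Data.Fin.Properties using (_≟_)
open import Data.List using (List; _∷_; _++_; allFin; cartesianProduct; map; tabulate)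
open import Data.List.Membership.Propositional using () renaming (_∈_ to _∈ₗ_)
open import Data.List.Membership.Propositional.Properties
  using (∈-allFin; ∈-cartesianProduct⁺; ∈-filter⁺; ∈-filter⁻; ∈-map⁺; ∈-map⁻)
open import Data.List.Membership.Propositional.Properties.WithK using (unique∧set⇒bag)
open import Data.List.Properties using (length-map; map-∘; map-tabulate)
open import Data.List.Relation.Binary.BagAndSetEquality using (∼bag⇒↭)
open import Data.List.Relation.Binary.Permutation.Propositional
  using (_↭_; ↭-prep; ↭-sym; ↭⇒↭ₛ; module PermutationReasoning)
open import Data.List.Relation.Binary.Permutation.Propositional.Properties
  using (++⁺ˡ; ↭-length; map⁺; shift)
import Data.List.Relation.Binary.Permutation.Setoid.Properties as Permutationₛ
open import Data.List.Relation.Unary.All as All using (All)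
import Data.List.Relation.Unary.All.Properties as All
open import Data.List.Relation.Unary.Any using (here; there)
open import Data.List.Relation.Unary.AllPairs using (_∷_)
open import Data.List.Relation.Unary.Unique.Propositional using (Unique)
import Data.List.Relation.Unary.Unique.Propositional.Properties as Unique
open import Data.Nat using (zero; suc; _≤_; z≤n; s≤s; ∣_-_∣)
open import Data.Nat.Properties
  using (+-identityʳ; +-suc; 1+n≢n; <⇒≢; m≤n⇒m≤1+n; m≤n⇒m<n∨m≡n; ≤-refl; ∣-∣-comm)
open import Data.Product using (_,_; map₂; proj₁; proj₂)
open import Data.Sum using (inj₁; inj₂)
open import Function using (_∘_; id)
open import Function.Bundles using (_⇔_; mk⇔)
open import Level using (0ℓ)
open import Relation.Binary using (Decidable; Irreflexive; Rel; Symmetric)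
open import Relation.Binary.PropositionalEquality
  using (cong; cong₂; refl; setoid; subst; sym; trans)
open import Relation.Nullary using (no)
open import Relation.Nullary.Decidable using (_×-dec_)
open import Relation.Unary using (_∪_)

-- In a duplicate-free list an element has at most one membership proof, so agreement as sets is
-- already agreement as bags, that is, a permutation.
unique∧⇔⇒↭ : ∀ {A : Set} {xs ys : List A} → Unique xs → Unique ys →
  (∀ {x} → x ∈ₗ xs ⇔ x ∈ₗ ys) → xs ↭ ys
unique∧⇔⇒↭ uxs uys xs⇔ys = ∼bag⇒↭ (unique∧set⇒bag uxs uys xs⇔ys)

Unique-resp-↭ : ∀ {A : Set} {xs ys : List A} → xs ↭ ys → Unique xs → Unique ys
Unique-resp-↭ {A} xs↭ys = Permutationₛ.Unique-resp-↭ (setoid A) (↭⇒↭ₛ xs↭ys)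

module _ {p} (G : Graph p) where
  open Graph G using (_~_; _~?_)

  edge? : (e : Fin p × Fin p) → _
  edge? (x , y) = (x <? y) ×-dec (x ~? y)

  ∈-edges⁺ : ∀ {x y} → x < y → x ~ y → (x , y) ∈ₗ edges G
  ∈-edges⁺ x<y x~y =
    ∈-filter⁺ edge? (∈-cartesianProduct⁺ (∈-allFin _) (∈-allFin _)) (x<y , x~y)

  ∈-edges⁻ : ∀ {x y} → (x , y) ∈ₗ edges G → x < y × x ~ y
  ∈-edges⁻ e∈ = proj₂ (∈-filter⁻ edge? {xs = cartesianProduct (allFin p) (allFin p)} e∈)

  edges-unique : Unique (edges G)
  edges-unique =
    Unique.filter⁺ edge? (Unique.cartesianProduct⁺ (Unique.allFin⁺ p) (Unique.allFin⁺ p))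

edgeLabel : ∀ {p} → Labeling p → Fin p × Fin p → ℕ
edgeLabel φ (x , y) = ∣ φ x - φ y ∣

-- Every entry of the list lies in `N φ` or `E G φ`, where `covers` bounds it. This is what makes
-- any label above `p + size G` fresh.
labels-bounded : ∀ {p} {G : Graph p} {φ} → IsTotalLabeling G φ →
  All (_≤ p + size G) (labels G φ)
labels-bounded {p} {G} {φ} total = All.++⁺
  (All.map⁺ (All.tabulate λ {x} _ → bounded (inj₁ (x , refl))))
  (All.map⁺ {f = edgeLabel φ} (All.tabulate λ {(x , y)} e∈ →
    bounded (inj₂ (x , y , proj₂ (∈-edges⁻ G e∈) , refl))))
  where
  bounded : ∀ {k} → k ∈ N φ ∪ E G φ → k ≤ p + size G
  bounded = proj₂ ∘ proj₁ (IsTotalLabeling.covers total)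

module _ {p} (G : Graph p) (x₀ : Fin p) where
  open Graph G using (_~_; _~?_; symm; irrefl)

  -- The leaf takes index `zero` and old nodes move up by `suc`, so the leaf is the smaller endpoint
  -- of its edge and heads `allFin (suc p)`.
  LeafAdjacent : Rel (Fin (suc p)) 0ℓ
  LeafAdjacent zero    zero    = ⊥
  LeafAdjacent zero    (suc y) = y ≡ x₀
  LeafAdjacent (suc x) zero    = x ≡ x₀
  LeafAdjacent (suc x) (suc y) = x ~ y

  leafAdjacent? : Decidable LeafAdjacent
  leafAdjacent? zero    zero    = no id
  leafAdjacent? zero    (suc y) = y ≟ x₀
  leafAdjacent? (suc x) zero    = x ≟ x₀
  leafAdjacent? (suc x) (suc y) = x ~? y

  leafAdjacent-sym : Symmetric LeafAdjacent
  leafAdjacent-sym {zero}  {suc y} y≡x₀ = y≡x₀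
  leafAdjacent-sym {suc x} {zero}  x≡x₀ = x≡x₀
  leafAdjacent-sym {suc x} {suc y} x~y  = symm x~y

  leafAdjacent-irrefl : Irreflexive _≡_ LeafAdjacent
  leafAdjacent-irrefl {suc x} refl x~x = irrefl refl x~x

  addLeaf : Graph (suc p)
  addLeaf = record
    { _~_    = LeafAdjacent
    ; _~?_   = leafAdjacent?
    ; symm   = λ {x} {y} → leafAdjacent-sym {x} {y}
    ; irrefl = leafAdjacent-irrefl
    }

  sucEdge : Fin p × Fin p → Fin (suc p) × Fin (suc p)
  sucEdge (x , y) = suc x , suc y

  addLeafEdges : List (Fin (suc p) × Fin (suc p))
  addLeafEdges = (zero , suc x₀) ∷ map sucEdge (edges G)

  -- Comparing members of two duplicate-free lists avoids unfolding the filtered product; `suc`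
  -- preserves the order, so old edges keep their orientation.
  edges-addLeaf : edges addLeaf ↭ addLeafEdges
  edges-addLeaf = unique∧⇔⇒↭ (edges-unique addLeaf) unique (mk⇔ to from)
    where
    unique : Unique addLeafEdges
    unique = All.map⁺ (All.tabulate λ _ ()) ∷
      Unique.map⁺ (λ { refl → refl }) (edges-unique G)

    to : ∀ {e} → e ∈ₗ edges addLeaf → e ∈ₗ addLeafEdges
    to {x , y} e∈ with x | y | ∈-edges⁻ addLeaf e∈
    -- The other two shapes put `zero` second, which contradicts smaller endpoint first.
    ... | zero  | suc _ | _ , refl         = here refl
    ... | suc _ | suc _ | s≤s x<y , x~y = there (∈-map⁺ sucEdge (∈-edges⁺ G x<y x~y))

    from : ∀ {e} → e ∈ₗ addLeafEdges → e ∈ₗ edges addLeaf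
    from (here refl) = ∈-edges⁺ addLeaf (s≤s z≤n) refl
    from (there e∈) with ∈-map⁻ sucEdge e∈
    ... | (x , y) , xy∈ , refl with ∈-edges⁻ G xy∈
    ...   | x<y , x~y = ∈-edges⁺ addLeaf (s≤s x<y) x~y

  size-addLeaf : size addLeaf ≡ suc (size G)
  size-addLeaf = trans (↭-length edges-addLeaf) (cong suc (length-map sucEdge (edges G)))

  module _ (φ : Labeling p) (total : IsTotalLabeling G φ) (φx₀≡1 : φ x₀ ≡ 1) where
    open IsTotalLabeling total

    M : ℕ
    M = p + size G

    leafLabeling : Labeling (suc p)
    leafLabeling zero    = 2 + M
    leafLabeling (suc x) = φ x

    leafEdgeLabel : ∣ 2 + M - φ x₀ ∣ ≡ 1 + M
    -- Once `φ x₀` is replaced by `1`, the difference computes to `1 + M`.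
    leafEdgeLabel = cong (∣ 2 + M -_∣) φx₀≡1

    -- The leaf's node label is already in front; its edge label follows all node labels and has to
    -- be shifted past them. A permutation suffices to transport `Unique`.
    labels-addLeaf : labels addLeaf leafLabeling ↭ 2 + M ∷ 1 + M ∷ labels G φ
    labels-addLeaf = ↭-prep (2 + M) (begin
      map leafLabeling (tabulate suc) ++ edgeLabels
        ≡⟨ cong (_++ edgeLabels) (trans (map-tabulate suc leafLabeling) (sym (map-tabulate id φ))) ⟩
      nodeLabels ++ edgeLabels
        ↭⟨ ++⁺ˡ nodeLabels (map⁺ (edgeLabel leafLabeling) edges-addLeaf) ⟩
      nodeLabels ++ ∣ 2 + M - φ x₀ ∣ ∷ map (edgeLabel leafLabeling) (map sucEdge (edges G))
        -- On shifted edges `edgeLabel leafLabeling` reduces to `edgeLabel φ`, so fusing the two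
        -- maps restores the old edge labels.
        ≡⟨ cong (nodeLabels ++_) (cong₂ _∷_ leafEdgeLabel (sym (map-∘ (edges G)))) ⟩
      nodeLabels ++ 1 + M ∷ map (edgeLabel φ) (edges G)
        ↭⟨ shift (1 + M) nodeLabels _ ⟩
      1 + M ∷ labels G φ ∎)
      where
      open PermutationReasoning
      nodeLabels edgeLabels : List ℕ
      nodeLabels = map φ (allFin p)
      edgeLabels = map (edgeLabel leafLabeling) (edges addLeaf)

    leafLabels-unique : Unique (2 + M ∷ 1 + M ∷ labels G φ)
    leafLabels-unique =
      (1+n≢n All.∷ All.map (λ k≤M → <⇒≢ (s≤s (m≤n⇒m≤1+n k≤M)) ∘ sym) bounded) ∷
      All.map (λ k≤M → <⇒≢ (s≤s k≤M) ∘ sym) bounded ∷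
      distinct
      where bounded = labels-bounded total

    -- One more node and one more edge raise the upper end by two, exactly enough for `1 + M` and
    -- `2 + M`.
    order+size-addLeaf : suc p + size addLeaf ≡ 2 + M
    order+size-addLeaf = cong suc (trans (cong (p +_) size-addLeaf) (+-suc p (size G)))

    addLeaf-total : IsTotalLabeling addLeaf leafLabeling
    addLeaf-total = record
      { positive = λ { zero → s≤s z≤n ; (suc x) → positive x }
      ; distinct = Unique-resp-↭ (↭-sym labels-addLeaf) leafLabels-unique
      ; covers   = (λ {k} → map₂ (subst (k ≤_) (sym order+size-addLeaf)) ∘ sound)
                 , (λ {k} (1≤k , k≤n) → complete 1≤k (subst (k ≤_) order+size-addLeaf k≤n))
      }
      where
      weaken : ∀ {k} → 1 ≤ k × k ≤ M → 1 ≤ k × k ≤ 2 + M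
      weaken (1≤k , k≤M) = 1≤k , m≤n⇒m≤1+n (m≤n⇒m≤1+n k≤M)

      leafEdge-bounds : ∀ {k} → 1 + M ≡ k → 1 ≤ k × k ≤ 2 + M
      leafEdge-bounds refl = s≤s z≤n , m≤n⇒m≤1+n ≤-refl

      sound : ∀ {k} → k ∈ N leafLabeling ∪ E addLeaf leafLabeling → 1 ≤ k × k ≤ 2 + M
      sound (inj₁ (zero , refl)) = s≤s z≤n , ≤-refl
      sound (inj₁ (suc x , eq)) = weaken (proj₁ covers (inj₁ (x , eq)))
      sound (inj₂ (zero , suc y , refl , eq)) =
        leafEdge-bounds (trans (sym leafEdgeLabel) eq)
      -- `E` ranges over ordered pairs, so the leaf edge also occurs reversed.
      sound (inj₂ (suc x , zero , refl , eq)) =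
        leafEdge-bounds (trans (sym leafEdgeLabel) (trans (∣-∣-comm (2 + M) (φ x₀)) eq))
      sound (inj₂ (suc x , suc y , x~y , eq)) = weaken (proj₁ covers (inj₂ (x , y , x~y , eq)))

      complete : ∀ {k} → 1 ≤ k → k ≤ 2 + M → k ∈ N leafLabeling ∪ E addLeaf leafLabeling
      -- The values `2 + M` and `1 + M` are split off in turn, being the leaf and its edge; what
      -- remains is at most `M` and comes from the old labeling.
      complete 1≤k k≤2+M with m≤n⇒m<n∨m≡n k≤2+M
      ... | inj₂ refl = inj₁ (zero , refl)
      ... | inj₁ (s≤s k≤1+M) with m≤n⇒m<n∨m≡n k≤1+M
      ...   | inj₂ refl = inj₂ (zero , suc x₀ , refl , leafEdgeLabel)
      ...   | inj₁ (s≤s k≤M) with proj₂ covers (1≤k , k≤M)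
      ...     | inj₁ (x , eq)           = inj₁ (suc x , eq)
      ...     | inj₂ (x , y , x~y , eq) = inj₂ (suc x , suc y , x~y , eq)

theorem8p5 : ∀ {p q : ℕ} (G : Graph p) → size G ≡ q →
    (φ : Labeling p) → IsTotalLabeling G φ → 1 ∈ N φ →
    (t : ℕ) → Σ[ H ∈ Graph (p + t) ] (size H ≡ q + t × Supergraceful H)
theorem8p5 {p} {q} G size≡q φ total _ zero =
  subst (λ n → Σ[ H ∈ Graph n ] (size H ≡ q + 0 × Supergraceful H)) (sym (+-identityʳ p))
    (G , trans size≡q (sym (+-identityʳ q)) , φ , total)
-- The leaf is added before recursing: the conclusion does not record a node labeled `1`, so the
-- graph it yields could not be extended further. The rewrites turn `p + suc t` and `q + suc t` into
-- the sums for `suc p` and `suc q`.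
theorem8p5 {p} {q} G size≡q φ total (x₀ , φx₀≡1) (suc t)
  rewrite +-suc p t | +-suc q t =
  theorem8p5 (addLeaf G x₀) (trans (size-addLeaf G x₀) (cong suc size≡q))
    (leafLabeling G x₀ φ total φx₀≡1) (addLeaf-total G x₀ φ total φx₀≡1)
    (suc x₀ , φx₀≡1) t
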